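{- For each integer $n\geq 1$: (1) $R_{2n+1}$ is divisible by $\gcd\big(n!\,(n-1)!\,R_n,\ (n+1)!\big)$; (2) $R_{2n}$ is divisible by $n!$.
   Context: A Latin square of order $n$ is an $n\times n$ array with entries from $\{1,\dots,n\}$ in which each row and each column contains each symbol exactly once. It is reduced if its first row is $(1,2,\dots,n)$ and its first column is $(1,2,\dots,n)^T$. $R_n$ denotes the number of reduced Latin squares of order $n$. -}

module Defs where

open import Data.Nat using (ℕ; zero; suc; _≡ᵇ_)
open import Data.Bool using (Bool; true; false; _∧_; if_then_else_)
open import Data.Fin using (Fin; toℕ)
open import Data.List.Base using (List; []; _∷_; length; filterᵇ; allFin; map; concatMap; foldr)

allᵇ : {A : Set} → (A → Bool) → List A → Bool
allᵇ p = foldr (λ x b → p x ∧ b) true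

-- An n×n array with entries from an n-element symbol set.
-- Symbol k ∈ {1,…,n} is represented by the element (k-1) : Fin n,
-- rows/columns i ∈ {1,…,n} by (i-1) : Fin n.
Array : ℕ → Set
Array n = Fin n → Fin n → Fin n

allFuns : {A : Set} → List A → (m : ℕ) → List (Fin m → A)
allFuns xs zero    = (λ ()) ∷ []
allFuns xs (suc m) = concatMap (λ x → map (λ f → λ { Fin.zero → x ; (Fin.suc i) → f i }) (allFuns xs m)) xs

allArrays : (n : ℕ) → List (Array n)
allArrays n = allFuns (allFuns (allFin n) n) n

_≟ᶠ_ : {n : ℕ} → Fin n → Fin n → Bool
i ≟ᶠ j = toℕ i ≡ᵇ toℕ j

countᶠ : (n : ℕ) → (Fin n → Bool) → ℕ
countᶠ n p = length (filterᵇ p (allFin n))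

isLatin : (n : ℕ) → Array n → Bool
isLatin n L =
  allᵇ (λ r → allᵇ (λ s → countᶠ n (λ c → L r c ≟ᶠ s) ≡ᵇ 1) (allFin n)) (allFin n)
  ∧ allᵇ (λ c → allᵇ (λ s → countᶠ n (λ r → L r c ≟ᶠ s) ≡ᵇ 1) (allFin n)) (allFin n)

isReduced : (n : ℕ) → Array n → Bool
isReduced zero    L = true
isReduced (suc n) L =
  allᵇ (λ c → L Fin.zero c ≟ᶠ c) (allFin (suc n))
  ∧ allᵇ (λ r → L r Fin.zero ≟ᶠ r) (allFin (suc n))

R : ℕ → ℕ
R n = length (filterᵇ (λ L → isLatin n L ∧ isReduced n L) (allArrays n))

{-# OPTIONS --safe #-}

-- Split the reduced Latin squares L of order m + k (m ≥ 1, k ≤ m + 1) by whether the leading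
-- m × m block is a subsquare on the first m symbols.
--
-- If it is not, the permutations of the last k points act freely by simultaneous renaming of
-- rows, columns and symbols: the fixed points of a non-trivial automorphism form a proper
-- subsquare, of order at most (m + k) / 2 and hence at most m, so they would be exactly the first
-- m points and the leading block would be a subsquare.  Thus k! divides the number of such L.
--
-- If it is, the first m symbols occur neither in the upper right nor in the lower left block.  So
-- one may independently replace the subsquare by any reduced Latin square, rename the first m
-- symbols within the lower right block, and permute the columns of the lower left block other
-- than the first.  Thus m! (m - 1)! R m divides the number of such L.
--
-- Both parts follow, with k = m + 1 and k = m.

module Submission where

open import Defs
open import Data.Bool using (Bool; T; _∧_)
open import Data.Bool.Properties using (T-∧; T?)
open import Data.Fin using (Fin; zero; suc; toℕ; punchIn; punchOut; splitAt; join; _↑ˡ_; _↑ʳ_)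
open import Data.Fin.Permutation using
  (Permutation′; _⟨$⟩ʳ_; _⟨$⟩ˡ_; insert; remove; insert-punchIn; insert-remove; inverseˡ;
   inverseʳ; _∘ₚ_; flip; lift₀; lift₀-cong; lift₀-id)
import Data.Fin.Permutation as Perm
open import Data.Fin.Properties using
  (injective⇒≤; _≟_; any?; toℕ-injective; punchOut-injective; punchIn-injective; all?;
   splitAt-↑ˡ; splitAt-join; suc-injective; splitAt-↑ʳ; splitAt⁻¹-↑ˡ; splitAt⁻¹-↑ʳ;
   join-splitAt; ↑ˡ-injective; ↑ʳ-injective; +↔⊎)
open import Data.List.Base using
  (List; []; _∷_; length; map; filter; lookup; concatMap; cartesianProductWith;
   cartesianProduct; _++_; allFin; filterᵇ)
import Data.List.Membership.DecSetoid as DecMembership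
import Data.List.Membership.Propositional as ≡Membership
open import Data.List.Membership.Propositional.Properties using (∈-allFin)
import Data.List.Membership.Setoid as Membership
open import Data.List.Membership.Setoid.Properties using
  (∈-map⁺; ∈-map⁻; ∈-filter⁺; ∈-filter⁻; ∈-lookup; ∈-resp-≈; ∉-resp-≈; index-injective;
   All[≉]⇒∉; ∈-cartesianProductWith⁺; ∈-cartesianProduct⁺; ∈-cartesianProduct⁻)
open import Data.List.Properties using (length-map; filter-notAll; length-++; length-tabulate)
open import Data.List.Relation.Unary.All using ([]; _∷_)
open import Data.List.Relation.Unary.AllPairs using (_∷_; [])
open import Data.List.Relation.Unary.Any using (here; there; index)
open import Data.List.Relation.Unary.Unique.Propositional.Properties using (allFin⁺)
open import Data.List.Relation.Unary.Unique.Setoid using (Unique)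
import Data.List.Relation.Unary.Unique.Setoid.Properties as Unique
open import Data.Nat using (ℕ; zero; suc; _+_; _*_; _≤_; _<_; _≡ᵇ_; _!; _∸_; _≥_)
open import Data.Nat.Divisibility using (_∣_; _∣0; ∣m∣n⇒∣m+n; ∣-refl; ∣-trans; ∣m⇒∣m*n; m∣m*n)
open import Data.Nat.GCD using (gcd; gcd[m,n]∣m; gcd[m,n]∣n)
open import Data.Nat.Induction using (<-wellFounded; Acc; acc)
open import Data.Nat.Properties using
  (≤-antisym; +-suc; ≤-reflexive; ≤-trans; +-comm; 1+n≰n; ≡ᵇ⇒≡; ≡⇒≡ᵇ; n≤1+n; +-assoc;
   +-identityʳ; +-monoʳ-≤; *-comm)
open import Data.Product using (_×_; _,_; proj₁; proj₂; ∃-syntax)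
open import Data.Product.Relation.Binary.Pointwise.NonDependent using (_×ₛ_)
open import Data.Sum using (_⊎_; inj₁; inj₂)
open import Data.Sum.Function.Propositional using (_⊎-↔_)
import Data.Vec.Functional.Relation.Binary.Pointwise.Properties as Pointwise
open import Function using (_∘_; Injective; id; Equivalence)
open import Function.Construct.Composition using (_↔-∘_)
open import Function.Construct.Symmetry using (↔-sym)
open import Level using (Level; _⊔_; 0ℓ)
open import Relation.Binary using (Setoid; DecSetoid)
open import Relation.Binary.PropositionalEquality using
  (_≡_; refl; sym; trans; cong; subst; cong₂; _≢_; module ≡-Reasoning)
import Relation.Binary.PropositionalEquality as ≡
open import Relation.Nullary using (¬_; yes; no; contradiction; ¬?; Dec)
open import Relation.Unary using (Pred; Decidable)

private variable
  a b c ℓ p i ℓᵢ : Level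

-- Counting duplicate-free lists and splitting them into classes.

length-filter-¬ : {A : Set a} {P : Pred A p} (P? : Decidable P) (xs : List A) →
  length xs ≡ length (filter P? xs) + length (filter (¬? ∘ P?) xs)
length-filter-¬ P? [] = refl
length-filter-¬ P? (x ∷ xs) with P? x
... | yes _ = cong suc (length-filter-¬ P? xs)
... | no  _ = trans (cong suc (length-filter-¬ P? xs)) (sym (+-suc _ _))

module _ (S : Setoid a ℓ) where
  open Setoid S using (_≈_)
  open Membership S using (_∈_)
  private module S = Setoid S

  lookup-injective : ∀ {xs} → Unique S xs → ∀ i j → lookup xs i ≈ lookup xs j → i ≡ j
  lookup-injective (_ ∷ _) zero zero _ = refl
  lookup-injective {_ ∷ xs} (x∉ ∷ _) zero (suc j) eq =
    contradiction (∈-resp-≈ S (S.sym eq) (∈-lookup S xs j)) (All[≉]⇒∉ S x∉)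
  lookup-injective {_ ∷ xs} (x∉ ∷ _) (suc i) zero eq =
    contradiction (∈-resp-≈ S eq (∈-lookup S xs i)) (All[≉]⇒∉ S x∉)
  lookup-injective (_ ∷ xs!) (suc i) (suc j) eq = cong suc (lookup-injective xs! i j eq)

  -- Sending each position of `xs` to a position of the same element in `ys` is injective.
  Unique-⊆⇒length≤ : ∀ {xs ys} → Unique S xs → (∀ {x} → x ∈ xs → x ∈ ys) → length xs ≤ length ys
  Unique-⊆⇒length≤ {xs} xs! xs⊆ys = injective⇒≤ {f = λ i → index (xs⊆ys (∈-lookup S xs i))}
    (λ {i} {j} eq → lookup-injective xs! i j (index-injective S _ _ eq))

module _ (I : Setoid i ℓᵢ) (D : DecSetoid a ℓ) where
  private
    module I = Setoid I
    module D = DecSetoid D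
    S = D.setoid
  open D using (_≈_)
  open Membership S using (_∈_)
  open Membership I using () renaming (_∈_ to _∈ᵢ_)
  open DecMembership D using (_∈?_)

  -- The sets {act i x ∣ i ∈ is} partition xs into classes of equal size; the indices need not
  -- form a group.
  record IndexedClasses (is : List I.Carrier) (act : I.Carrier → D.Carrier → D.Carrier)
                        (xs : List D.Carrier) : Set (i ⊔ ℓᵢ ⊔ a ⊔ ℓ) where
    field
      closed : ∀ {i x} → i ∈ᵢ is → x ∈ xs → act i x ∈ xs
      free   : ∀ {i j x} → x ∈ xs → act i x ≈ act j x → i I.≈ j
      covers : ∀ {x} → x ∈ xs → ∃[ i ] (i ∈ᵢ is × x ≈ act i x)
      linked : ∀ {i j x y} → x ∈ xs → y ∈ xs → i ∈ᵢ is → j ∈ᵢ is →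
               act i x ≈ act j y → ∃[ l ] (l ∈ᵢ is × y ≈ act l x)

  -- Remove the class of the head and recurse on the rest. By `free` a class has as many elements as
  -- there are indices, and by `linked` the rest is again a union of classes.
  indexedClasses⇒∣length : ∀ {is} → Unique I is → (act : I.Carrier → D.Carrier → D.Carrier) →
    (∀ {i j x y} → i I.≈ j → x ≈ y → act i x ≈ act j y) →
    ∀ xs → Unique S xs → IndexedClasses is act xs → length is ∣ length xs
  indexedClasses⇒∣length {is} is! act act-cong xs = go xs (<-wellFounded (length xs))
    where
    go : ∀ xs → Acc _<_ (length xs) → Unique S xs → IndexedClasses is act xs → length is ∣ length xs
    go [] _ _ _ = _ ∣0
    go xs@(x₀ ∷ _) (acc rec) xs! classes =
      subst (length is ∣_) (sym split)
        (∣m∣n⇒∣m+n ∣-refl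
          (go rest (rec rest<xs) (Unique.filter⁺ S (¬? ∘ (_∈? orbit)) xs!) record
            { closed = rest-closed
            ; free   = free ∘ proj₁ ∘ rest⁻
            ; covers = covers ∘ proj₁ ∘ rest⁻
            ; linked = λ x∈ y∈ → linked (proj₁ (rest⁻ x∈)) (proj₁ (rest⁻ y∈))
            }))
      where
      open IndexedClasses classes
      x₀∈ : x₀ ∈ xs
      x₀∈ = here D.refl
      orbit = map (λ i → act i x₀) is
      inside = filter (_∈? orbit) xs
      rest = filter (¬? ∘ (_∈? orbit)) xs

      orbit⁻ : ∀ {y} → y ∈ orbit → ∃[ i ] (i ∈ᵢ is × y ≈ act i x₀)
      orbit⁻ = ∈-map⁻ I S
      orbit⁺ : ∀ {i y} → i ∈ᵢ is → y ≈ act i x₀ → y ∈ orbit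
      orbit⁺ i∈ y≈ = ∈-resp-≈ S (D.sym y≈) (∈-map⁺ I S (λ i≈j → act-cong i≈j D.refl) i∈)
      rest⁻ : ∀ {y} → y ∈ rest → y ∈ xs × ¬ y ∈ orbit
      rest⁻ = ∈-filter⁻ S (¬? ∘ (_∈? orbit)) (∉-resp-≈ S)
      orbit-unique : Unique S orbit
      orbit-unique = Unique.map⁺ I S (free x₀∈) is!
      orbit⊆ : ∀ {y} → y ∈ orbit → y ∈ inside
      orbit⊆ y∈ with i , i∈ , y≈ ← orbit⁻ y∈ =
        ∈-filter⁺ S (_∈? orbit) (∈-resp-≈ S) (∈-resp-≈ S (D.sym y≈) (closed i∈ x₀∈)) y∈
      orbit-length : length inside ≡ length is
      orbit-length = trans
        (≤-antisym (Unique-⊆⇒length≤ S (Unique.filter⁺ S (_∈? orbit) xs!)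
                     (proj₂ ∘ ∈-filter⁻ S (_∈? orbit) (∈-resp-≈ S)))
                   (Unique-⊆⇒length≤ S orbit-unique orbit⊆))
        (length-map _ is)
      split : length xs ≡ length is + length rest
      split = trans (length-filter-¬ (_∈? orbit) xs) (cong (_+ length rest) orbit-length)
      rest<xs : length rest < length xs
      -- `covers` puts `x₀` into its own class, so at least `x₀` is removed.
      rest<xs with i , i∈ , x₀≈ ← covers x₀∈ =
        filter-notAll (¬? ∘ (_∈? orbit)) xs (here (λ x₀∉ → x₀∉ (orbit⁺ i∈ x₀≈)))
      rest-closed : ∀ {i y} → i ∈ᵢ is → y ∈ rest → act i y ∈ rest
      rest-closed i∈ y∈ with y∈xs , y∉ ← rest⁻ y∈ =
        ∈-filter⁺ S (¬? ∘ (_∈? orbit)) (∉-resp-≈ S) (closed i∈ y∈xs) λ iy∈ →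
          -- If `act i y` lay in the class of `x₀`, then `linked` would place `y` there too.
          let j , j∈ , iy≈ = orbit⁻ iy∈
              l , l∈ , y≈ = linked x₀∈ y∈xs j∈ i∈ (D.sym iy≈)
          in y∉ (orbit⁺ l∈ y≈)

-- Enumerating all functions.

-- Brings `allFuns` into the form to which the results on uniqueness and membership in products
-- apply.
concatMap-map≡cartesianProductWith : {A : Set a} {B : Set b} {C : Set c} (f : A → B → C) (xs : List A) (ys : List B) →
  concatMap (λ x → map (f x) ys) xs ≡ cartesianProductWith f xs ys
concatMap-map≡cartesianProductWith f [] ys = refl
concatMap-map≡cartesianProductWith f (x ∷ xs) ys = cong (map (f x) ys ++_) (concatMap-map≡cartesianProductWith f xs ys)

length-cartesianProductWith : {A : Set a} {B : Set b} {C : Set c} (f : A → B → C) (xs : List A) (ys : List B) →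
  length (cartesianProductWith f xs ys) ≡ length xs * length ys
length-cartesianProductWith f [] ys = refl
length-cartesianProductWith f (x ∷ xs) ys = trans (length-++ (map (f x) ys))
  (cong₂ _+_ (length-map (f x) ys) (length-cartesianProductWith f xs ys))

module _ (S : Setoid 0ℓ 0ℓ) where
  open Membership using (_∈_)

  -- Functions are compared pointwise: a function agrees with its reassembly from head and tail
  -- value by value, not definitionally.
  allFuns-unique : ∀ {xs} → Unique S xs → ∀ m → Unique (Pointwise.setoid S m) (allFuns xs m)
  allFuns-unique xs! zero = [] ∷ []
  allFuns-unique {xs} xs! (suc m) = subst (Unique (Pointwise.setoid S (suc m)))
    (sym (concatMap-map≡cartesianProductWith _ xs (allFuns xs m)))
    (Unique.cartesianProductWith⁺ S (Pointwise.setoid S m) (Pointwise.setoid S (suc m)) _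
      (λ eq → eq zero , eq ∘ suc) xs! (allFuns-unique xs! m))

  allFuns-complete : ∀ {xs} → (∀ x → _∈_ S x xs) → ∀ m f → _∈_ (Pointwise.setoid S m) f (allFuns xs m)
  allFuns-complete ∈xs zero f = here λ ()
  allFuns-complete {xs} ∈xs (suc m) f = subst (_∈_ (Pointwise.setoid S (suc m)) f)
    (sym (concatMap-map≡cartesianProductWith _ xs (allFuns xs m)))
    (∈-resp-≈ (Pointwise.setoid S (suc m))
      (λ { zero → Setoid.refl S ; (suc i) → Setoid.refl S })
      (∈-cartesianProductWith⁺ S (Pointwise.setoid S m) (Pointwise.setoid S (suc m))
        (λ { x≈ f≈ zero → x≈ ; x≈ f≈ (suc i) → f≈ i })
        (∈xs (f zero)) (allFuns-complete ∈xs m (f ∘ suc))))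

-- Enumerating permutations.

permutationₛ : ℕ → Setoid 0ℓ 0ℓ
permutationₛ k = record
  { Carrier = Permutation′ k
  ; _≈_ = Perm._≈_
  ; isEquivalence = record
    { refl = λ _ → refl ; sym = λ eq i → sym (eq i) ; trans = λ p q i → trans (p i) (q i) }
  }

-- Choosing the image of `zero` and then a permutation of the other points mirrors the recursion of
-- `k !`.
permutations : ∀ k → List (Permutation′ k)
permutations zero = Perm.id ∷ []
permutations (suc k) = cartesianProductWith (insert zero) (allFin (suc k)) (permutations k)

length-permutations : ∀ k → length (permutations k) ≡ k !
length-permutations zero = refl
length-permutations (suc k) = trans (length-cartesianProductWith (insert zero) (allFin (suc k)) (permutations k))
  (cong₂ _*_ (length-tabulate {n = suc k} id) (length-permutations k))

permutations-unique : ∀ k → Unique (permutationₛ k) (permutations k)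
permutations-unique zero = [] ∷ []
permutations-unique (suc k) =
  Unique.cartesianProductWith⁺ (≡.setoid _) (permutationₛ k) (permutationₛ (suc k)) (insert zero)
  insert-injective (allFin⁺ (suc k)) (permutations-unique k)
  where
  insert-injective : ∀ {i j : Fin (suc k)} {π ρ : Permutation′ k} →
    insert zero i π Perm.≈ insert zero j ρ → i ≡ j × π Perm.≈ ρ
  -- At `zero` the two insertions take the values `i` and `j`; elsewhere `punchIn i` can be
  -- cancelled.
  insert-injective {i} {j} {π} {ρ} eq with refl ← eq zero = refl , λ l → punchIn-injective i _ _
    (trans (sym (insert-punchIn zero i π l)) (trans (eq (suc l)) (insert-punchIn zero i ρ l)))

permutations-complete : ∀ {k} (π : Permutation′ k) → Membership._∈_ (permutationₛ k) π (permutations k)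
permutations-complete {zero} π = here λ ()
permutations-complete {suc k} π = ∈-resp-≈ (permutationₛ (suc k))
  {x = insert zero (π ⟨$⟩ʳ zero) (remove zero π)} {y = π}
  (insert-remove zero π)
  (∈-cartesianProductWith⁺ (≡.setoid _) (permutationₛ k) (permutationₛ (suc k)) insert-cong
    (∈-allFin (π ⟨$⟩ʳ zero)) (permutations-complete (remove zero π)))
  where
  insert-cong : ∀ {i j : Fin (suc k)} {π ρ : Permutation′ k} → i ≡ j → π Perm.≈ ρ →
    insert zero i π Perm.≈ insert zero j ρ
  insert-cong refl eq zero = refl
  insert-cong {i} {_} {π} {ρ} refl eq (suc l) = trans (insert-punchIn zero i π l)
    (trans (cong (punchIn i) (eq l)) (sym (insert-punchIn zero i ρ l)))

-- Reduced Latin squares: from the Boolean test to injectivity.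

-- If a value were missed, punching it out would inject `suc n` points into `n`.
injective⇒surjective : ∀ {n} {f : Fin n → Fin n} → Injective _≡_ _≡_ f → ∀ s → ∃[ c ] f c ≡ s
injective⇒surjective {suc n} {f} f-inj s with any? (λ c → f c ≟ s)
... | yes found = found
... | no s∉f = contradiction (injective⇒≤ {f = λ c → punchOut (s≢f c)}
    (λ {c} {d} eq → f-inj (punchOut-injective (s≢f c) (s≢f d) eq))) 1+n≰n
  where
  s≢f : ∀ c → s ≢ f c
  s≢f c eq = s∉f (c , sym eq)

≟ᶠ⇒≡ : ∀ {n} {i j : Fin n} → T (i ≟ᶠ j) → i ≡ j
≟ᶠ⇒≡ t = toℕ-injective (≡ᵇ⇒≡ _ _ t)

≡⇒≟ᶠ : ∀ {n} {i j : Fin n} → i ≡ j → T (i ≟ᶠ j)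
≡⇒≟ᶠ eq = ≡⇒≡ᵇ _ _ (cong toℕ eq)

allᵇ-allFin⁺ : ∀ {n} (p : Fin n → Bool) → (∀ i → T (p i)) → T (allᵇ p (allFin n))
allᵇ-allFin⁺ {n} p ps = go (allFin n)
  where
  go : ∀ xs → T (allᵇ p xs)
  go [] = _
  go (x ∷ xs) = Equivalence.from T-∧ (ps x , go xs)

allᵇ-allFin⁻ : ∀ {n} (p : Fin n → Bool) → T (allᵇ p (allFin n)) → ∀ i → T (p i)
allᵇ-allFin⁻ {n} p t i = go (allFin n) t (∈-allFin i)
  where
  go : ∀ xs → T (allᵇ p xs) → i ≡Membership.∈ xs → T (p i)
  go (x ∷ xs) t (here refl) = proj₁ (Equivalence.to T-∧ t)
  go (x ∷ xs) t (there i∈)  = go xs (proj₂ (Equivalence.to (T-∧ {p x}) t)) i∈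

module _ {n : ℕ} (p : Fin n → Bool) where
  private
    F = ≡.setoid (Fin n)
    hits = filterᵇ p (allFin n)

    hit : ∀ {c} → T (p c) → c ≡Membership.∈ hits
    hit {c} pc = ∈-filter⁺ F (T? ∘ p) (λ { refl t → t }) (∈-allFin c) pc

  countᶠ≡1⁻ : T (countᶠ n p ≡ᵇ 1) → ∀ {c d} → T (p c) → T (p d) → c ≡ d
  countᶠ≡1⁻ t pc pd = go hits (≡ᵇ⇒≡ _ 1 t) (hit pc) (hit pd)
    where
    go : ∀ xs → length xs ≡ 1 → ∀ {c d} → c ≡Membership.∈ xs → d ≡Membership.∈ xs → c ≡ d
    go (_ ∷ []) _ (here refl) (here refl) = refl

  countᶠ≡1⁺ : ∀ {c} → T (p c) → (∀ {d} → T (p d) → d ≡ c) → T (countᶠ n p ≡ᵇ 1)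
  countᶠ≡1⁺ {c} pc only = ≡⇒≡ᵇ _ 1 (≤-antisym
    (Unique-⊆⇒length≤ F {ys = c ∷ []} (Unique.filter⁺ F (T? ∘ p) (allFin⁺ n))
      (λ {d} d∈ → here (only (proj₂ (∈-filter⁻ F (T? ∘ p) (λ { refl t → t }) {xs = allFin n} d∈)))))
    (Unique-⊆⇒length≤ F {xs = c ∷ []} ([] ∷ []) (λ { (here refl) → hit pc })))

-- Both positions are hits for the common value `f d`, which is hit once.
countᶠ≡1⇒injective : ∀ {n} (f : Fin n → Fin n) → (∀ s → T (countᶠ n (λ c → f c ≟ᶠ s) ≡ᵇ 1)) → Injective _≡_ _≡_ f
countᶠ≡1⇒injective f once {c} {d} eq = countᶠ≡1⁻ (λ e → f e ≟ᶠ f d) (once (f d)) (≡⇒≟ᶠ eq) (≡⇒≟ᶠ {i = f d} refl)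

-- Surjectivity provides a position for each symbol and injectivity excludes a second one.
injective⇒countᶠ≡1 : ∀ {n} (f : Fin n → Fin n) → Injective _≡_ _≡_ f → ∀ s → T (countᶠ n (λ c → f c ≟ᶠ s) ≡ᵇ 1)
injective⇒countᶠ≡1 f f-inj s with c , refl ← injective⇒surjective f-inj s =
  countᶠ≡1⁺ (λ e → f e ≟ᶠ f c) {c} (≡⇒≟ᶠ {i = f c} refl) (λ t → f-inj (≟ᶠ⇒≡ t))

arrayₛ : ℕ → DecSetoid 0ℓ 0ℓ
arrayₛ n = Pointwise.decSetoid (Pointwise.decSetoid (≡.decSetoid (_≟_ {n})) n) n

infix 4 _≗₂_
_≗₂_ : ∀ {n} → Array n → Array n → Set
L ≗₂ M = ∀ i j → L i j ≡ M i j

-- The propositional form of the Boolean test. On finite rows and columns, containing each symbol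
-- exactly once amounts to injectivity.
record ReducedLatin {n : ℕ} (L : Array (suc n)) : Set where
  field
    row-injective    : ∀ r {c d} → L r c ≡ L r d → c ≡ d
    column-injective : ∀ c {r s} → L r c ≡ L s c → r ≡ s
    first-row        : ∀ c → L zero c ≡ c
    first-column     : ∀ r → L r zero ≡ r

open ReducedLatin

ReducedLatin-resp : ∀ {n} {L M : Array (suc n)} → L ≗₂ M → ReducedLatin L → ReducedLatin M
ReducedLatin-resp L≈M rl = record
  { row-injective = λ r {c} {d} eq → row-injective rl r (trans (L≈M r c) (trans eq (sym (L≈M r d))))
  ; column-injective = λ c {r} {s} eq → column-injective rl c (trans (L≈M r c) (trans eq (sym (L≈M s c))))
  ; first-row = λ c → trans (sym (L≈M _ _)) (first-row rl c)
  ; first-column = λ r → trans (sym (L≈M _ _)) (first-column rl r)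
  }

module _ (n : ℕ) where
  private
    N = suc n
    F = ≡.setoid (Fin N)
    S = DecSetoid.setoid (arrayₛ N)
    rlᵇ : Array N → Bool
    rlᵇ L = isLatin N L ∧ isReduced N L
  open Membership S using (_∈_)

  rlᵇ⁻ : ∀ L → T (rlᵇ L) → ReducedLatin L
  rlᵇ⁻ L t with latin , reduced ← Equivalence.to (T-∧ {isLatin N L}) t
    with rows , columns ← Equivalence.to
           (T-∧ {allᵇ (λ r → allᵇ (λ s → countᶠ N (λ c → L r c ≟ᶠ s) ≡ᵇ 1) (allFin N)) (allFin N)}) latin
       | row , column ← Equivalence.to (T-∧ {allᵇ (λ c → L zero c ≟ᶠ c) (allFin N)}) reduced = record
    { row-injective = λ r → countᶠ≡1⇒injective (L r) (allᵇ-allFin⁻ _ (allᵇ-allFin⁻ _ rows r))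
    ; column-injective = λ c → countᶠ≡1⇒injective (λ r → L r c) (allᵇ-allFin⁻ _ (allᵇ-allFin⁻ _ columns c))
    ; first-row = λ c → ≟ᶠ⇒≡ (allᵇ-allFin⁻ _ row c)
    ; first-column = λ r → ≟ᶠ⇒≡ (allᵇ-allFin⁻ _ column r)
    }

  rlᵇ⁺ : ∀ L → ReducedLatin L → T (rlᵇ L)
  rlᵇ⁺ L rl = Equivalence.from T-∧
    ( Equivalence.from T-∧
        ( allᵇ-allFin⁺ _ (λ r → allᵇ-allFin⁺ _ (injective⇒countᶠ≡1 (L r) (row-injective rl r)))
        , allᵇ-allFin⁺ _ (λ c → allᵇ-allFin⁺ _ (injective⇒countᶠ≡1 (λ r → L r c) (column-injective rl c))))
    , Equivalence.from T-∧
        ( allᵇ-allFin⁺ _ (λ c → ≡⇒≟ᶠ (first-row rl c))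
        , allᵇ-allFin⁺ _ (λ r → ≡⇒≟ᶠ (first-column rl r))))

  -- The length of this list is `R (suc n)` by definition.
  reducedLatins : List (Array N)
  reducedLatins = filterᵇ rlᵇ (allArrays N)

  private
    rlᵇ-resp : ∀ {L M} → L ≗₂ M → T (rlᵇ L) → T (rlᵇ M)
    rlᵇ-resp {L} {M} L≈M = rlᵇ⁺ M ∘ ReducedLatin-resp L≈M ∘ rlᵇ⁻ L

  reducedLatins-unique : Unique S reducedLatins
  reducedLatins-unique = Unique.filter⁺ S (T? ∘ rlᵇ)
    (allFuns-unique (Pointwise.setoid F N) (allFuns-unique F (allFin⁺ N) N) N)

  ∈-reducedLatins⁺ : ∀ {L} → ReducedLatin L → L ∈ reducedLatins
  ∈-reducedLatins⁺ {L} rl = ∈-filter⁺ S (T? ∘ rlᵇ) (λ {L} {M} → rlᵇ-resp {L} {M})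
    (allFuns-complete (Pointwise.setoid F N) (allFuns-complete F ∈-allFin N) N L) (rlᵇ⁺ L rl)

  ∈-reducedLatins⁻ : ∀ {L} → L ∈ reducedLatins → ReducedLatin L
  ∈-reducedLatins⁻ {L} L∈ = rlᵇ⁻ L (proj₂ (∈-filter⁻ S (T? ∘ rlᵇ)
    (λ {L} {M} → rlᵇ-resp {L} {M}) {xs = allArrays N} L∈))

open ReducedLatin

-- Low and high points, and block sums of permutations.

⟨$⟩ʳ-injective : ∀ {n} (π : Permutation′ n) → Injective _≡_ _≡_ (π ⟨$⟩ʳ_)
⟨$⟩ʳ-injective π eq = trans (sym (inverseˡ π)) (trans (cong (π ⟨$⟩ˡ_) eq) (inverseˡ π))

-- A view: matching on it rewrites a point as a low or a high one.
data Half (m k : ℕ) : Fin (m + k) → Set where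
  low  : (i : Fin m) → Half m k (i ↑ˡ k)
  high : (j : Fin k) → Half m k (m ↑ʳ j)

half : ∀ m k (x : Fin (m + k)) → Half m k x
half m k x with splitAt m x in eq
... | inj₁ i = subst (Half m k) (splitAt⁻¹-↑ˡ eq) (low i)
... | inj₂ j = subst (Half m k) (splitAt⁻¹-↑ʳ eq) (high j)

splitAt-injective : ∀ m k {x y : Fin (m + k)} → splitAt m x ≡ splitAt m y → x ≡ y
splitAt-injective m k {x} {y} eq =
  trans (sym (join-splitAt m k x)) (trans (cong (join m k) eq) (join-splitAt m k y))

low≢high : ∀ {m k} {i : Fin m} {j : Fin k} → i ↑ˡ k ≢ m ↑ʳ j
low≢high {m} {k} {i} {j} eq with () ← trans (sym (splitAt-↑ˡ m i k)) (trans (cong (splitAt m) eq) (splitAt-↑ʳ m k j))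

module _ {m k : ℕ} where

  infixr 7 _⊕_
  _⊕_ : Permutation′ m → Permutation′ k → Permutation′ (m + k)
  π ⊕ ρ = ↔-sym +↔⊎ ↔-∘ ((π ⊎-↔ ρ) ↔-∘ +↔⊎)

  ⊕-low : ∀ π ρ i → (π ⊕ ρ) ⟨$⟩ʳ (i ↑ˡ k) ≡ (π ⟨$⟩ʳ i) ↑ˡ k
  ⊕-low π ρ i rewrite splitAt-↑ˡ m i k = refl

  ⊕-high : ∀ π ρ j → (π ⊕ ρ) ⟨$⟩ʳ (m ↑ʳ j) ≡ m ↑ʳ (ρ ⟨$⟩ʳ j)
  ⊕-high π ρ j rewrite splitAt-↑ʳ m k j = refl

  ⊕-cong : ∀ {π π′ ρ ρ′} → π Perm.≈ π′ → ρ Perm.≈ ρ′ → π ⊕ ρ Perm.≈ π′ ⊕ ρ′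
  ⊕-cong {π} {π′} {ρ} {ρ′} π≈ ρ≈ x with half m k x
  ... | low i  = trans (⊕-low π ρ i) (trans (cong (_↑ˡ k) (π≈ i)) (sym (⊕-low π′ ρ′ i)))
  ... | high j = trans (⊕-high π ρ j) (trans (cong (m ↑ʳ_) (ρ≈ j)) (sym (⊕-high π′ ρ′ j)))

  -- Here `∘ₚ` applies its left argument first.
  ⊕-comp : ∀ π π′ ρ ρ′ → (π ⊕ ρ) ∘ₚ (π′ ⊕ ρ′) Perm.≈ (π ∘ₚ π′) ⊕ (ρ ∘ₚ ρ′)
  ⊕-comp π π′ ρ ρ′ x with half m k x
  ... | low i  =
    trans (cong ((π′ ⊕ ρ′) ⟨$⟩ʳ_) (⊕-low π ρ i)) (trans (⊕-low π′ ρ′ _) (sym (⊕-low (π ∘ₚ π′) (ρ ∘ₚ ρ′) i)))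
  ... | high j =
    trans (cong ((π′ ⊕ ρ′) ⟨$⟩ʳ_) (⊕-high π ρ j)) (trans (⊕-high π′ ρ′ _) (sym (⊕-high (π ∘ₚ π′) (ρ ∘ₚ ρ′) j)))

  ⊕-id : Perm.id ⊕ Perm.id Perm.≈ Perm.id {m + k}
  ⊕-id x with half m k x
  ... | low i  = ⊕-low Perm.id Perm.id i
  ... | high j = ⊕-high Perm.id Perm.id j

-- `Perm.≈` compares forward maps only, so agreement of the inverses must be derived.
⟨$⟩ˡ-cong : ∀ {n} {π ρ : Permutation′ n} → π Perm.≈ ρ → flip π Perm.≈ flip ρ
⟨$⟩ˡ-cong {π = π} {ρ} eq x = ⟨$⟩ʳ-injective ρ (trans (sym (eq _)) (trans (inverseʳ π) (sym (inverseʳ ρ))))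

-- Squares without the leading subsquare: renaming the last points.

module _ (m′ k : ℕ) where
  private
    m = suc m′
    S = DecSetoid.setoid (arrayₛ (m + k))
  open Membership S using (_∈_)

  -- The symbols are fixed to be the low ones because the first row of a reduced square already puts
  -- exactly these into the leading block. The witness `q` later serves as the entry of `block`.
  Subsquare : Array (m + k) → Set
  Subsquare L = ∀ i j → ∃[ q ] L (i ↑ˡ k) (j ↑ˡ k) ≡ q ↑ˡ k

  Subsquare? : ∀ L → Dec (Subsquare L)
  Subsquare? L = all? λ i → all? λ j → any? λ q → L (i ↑ˡ k) (j ↑ˡ k) ≟ q ↑ˡ k

  Subsquare-resp : ∀ {L M} → L ≗₂ M → Subsquare L → Subsquare M
  Subsquare-resp L≈M sub i j with q , eq ← sub i j = q , trans (sym (L≈M _ _)) eq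

  ¬Subsquare-resp : ∀ {L M} → L ≗₂ M → ¬ Subsquare L → ¬ Subsquare M
  ¬Subsquare-resp {L} {M} L≈M ¬sub sub = ¬sub (Subsquare-resp {M} {L} (λ i j → sym (L≈M i j)) sub)

  -- A finite search turns the negation into an explicit entry.
  ¬Subsquare⇒high : ∀ {L} → ¬ Subsquare L → ∃[ i ] ∃[ j ] ∃[ y ] L (i ↑ˡ k) (j ↑ˡ k) ≡ m ↑ʳ y
  ¬Subsquare⇒high {L} ¬sub
    with any? (λ i → any? λ j → any? λ y → L (i ↑ˡ k) (j ↑ˡ k) ≟ m ↑ʳ y)
  ... | yes found = found
  ... | no none = contradiction all-low ¬sub
    where
    all-low : Subsquare L
    all-low i j with L (i ↑ˡ k) (j ↑ˡ k) in eq
    ... | x with half m k x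
    ...   | low q  = q , refl
    ...   | high y = contradiction (i , j , y , eq) none

  -- θ fixes the first m points and any high entry of the leading block.  If θ moves x, then row x
  -- sends these m + 1 fixed columns to moved symbols, giving 2m + 2 different symbols in all.
  rigid : k ≤ suc m → ∀ {L} → ReducedLatin L → ¬ Subsquare L →
    (θ : Fin (m + k) → Fin (m + k)) → (∀ i j → θ (L i j) ≡ L (θ i) (θ j)) →
    (∀ i → θ (i ↑ˡ k) ≡ i ↑ˡ k) → ∀ x → θ x ≡ x
  rigid k≤1+m {L} rl ¬sub θ auto θ-low x with θ x ≟ x
  ... | yes fixed = fixed
  ... | no moved with i₀ , j₀ , y , eq ← ¬Subsquare⇒high {L} ¬sub =
    -- Injectivity of `h` gives `suc m + suc m ≤ m + k`, whereas `m + k ≤ m + suc m`.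
    contradiction (≤-trans (injective⇒≤ (λ eq → splitAt-injective (suc m) (suc m) (h-injective _ _ eq)))
      (+-monoʳ-≤ m k≤1+m)) 1+n≰n
    where
    f : Fin (suc m) → Fin (m + k)
    f zero    = m ↑ʳ y
    f (suc i) = i ↑ˡ k

    f-fixed : ∀ i → θ (f i) ≡ f i
    f-fixed zero = trans (cong θ (sym eq)) (trans (auto _ _) (trans (cong₂ L (θ-low i₀) (θ-low j₀)) eq))
    f-fixed (suc i) = θ-low i

    f-injective : ∀ i j → f i ≡ f j → i ≡ j
    f-injective zero    zero    _  = refl
    f-injective zero    (suc j) eq = contradiction (sym eq) low≢high
    f-injective (suc i) zero    eq = contradiction eq low≢high
    f-injective (suc i) (suc j) eq = cong suc (↑ˡ-injective k i j eq)

    Lxf-moved : ∀ i → θ (L x (f i)) ≢ L x (f i)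
    Lxf-moved i fixed = moved (column-injective rl (f i)
      -- A fixed entry would occur in rows `x` and `θ x` of the same column `f i`, forcing
      -- `θ x ≡ x`.
      (trans (cong (L (θ x)) (sym (f-fixed i))) (trans (sym (auto x (f i))) fixed)))

    h : Fin (suc m) ⊎ Fin (suc m) → Fin (m + k)
    h (inj₁ i) = f i
    h (inj₂ i) = L x (f i)

    h-injective : ∀ u v → h u ≡ h v → u ≡ v
    h-injective (inj₁ i) (inj₁ j) eq = cong inj₁ (f-injective i j eq)
    h-injective (inj₁ i) (inj₂ j) eq = contradiction (trans (cong θ (sym eq)) (trans (f-fixed i) eq)) (Lxf-moved j)
    h-injective (inj₂ i) (inj₁ j) eq = contradiction (trans (cong θ eq) (trans (f-fixed j) (sym eq))) (Lxf-moved i)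
    h-injective (inj₂ i) (inj₂ j) eq = cong inj₂ (f-injective i j (row-injective rl x eq))

  -- An isomorphic copy of `L`. Since `s` fixes the low points, `zero` among them, the copy is again
  -- reduced.
  conjugate : Permutation′ k → Array (m + k) → Array (m + k)
  conjugate σ L i j = s ⟨$⟩ˡ L (s ⟨$⟩ʳ i) (s ⟨$⟩ʳ j)
    where s = Perm.id ⊕ σ

  conjugate-cong : ∀ {σ ρ L M} → σ Perm.≈ ρ → L ≗₂ M → conjugate σ L ≗₂ conjugate ρ M
  conjugate-cong {σ} {ρ} {L} {M} σ≈ρ L≈M i j = trans
    (⟨$⟩ˡ-cong {π = s} {ρ = t} s≈t (L (s ⟨$⟩ʳ i) (s ⟨$⟩ʳ j)))
    (cong (t ⟨$⟩ˡ_) (trans (L≈M _ _) (cong₂ M (s≈t i) (s≈t j))))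
    where
    s = Perm.id ⊕ σ
    t = Perm.id ⊕ ρ
    s≈t : s Perm.≈ t
    s≈t = ⊕-cong {π = Perm.id} {π′ = Perm.id} {ρ = σ} {ρ′ = ρ} (λ _ → refl) σ≈ρ

  conjugate-reducedLatin : ∀ σ {L} → ReducedLatin L → ReducedLatin (conjugate σ L)
  conjugate-reducedLatin σ {L} rl = record
    { row-injective = λ r eq → s-inj (row-injective rl _ (s⁻¹-inj eq))
    ; column-injective = λ c eq → s-inj (column-injective rl _ (s⁻¹-inj eq))
    -- `s ⟨$⟩ʳ zero` computes to `zero`, because `m` is a successor.
    ; first-row = λ c → trans (cong (s ⟨$⟩ˡ_) (first-row rl _)) (inverseˡ s)
    ; first-column = λ r → trans (cong (s ⟨$⟩ˡ_) (first-column rl _)) (inverseˡ s)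
    }
    where
    s = Perm.id ⊕ σ
    s-inj : Injective _≡_ _≡_ (s ⟨$⟩ʳ_)
    s-inj = ⟨$⟩ʳ-injective s
    s⁻¹-inj : Injective _≡_ _≡_ (s ⟨$⟩ˡ_)
    s⁻¹-inj = ⟨$⟩ʳ-injective (flip s)

  -- On low rows and columns `s` is the identity, and applying it to a low entry leaves that entry
  -- low.
  conjugate-subsquare⁻ : ∀ σ {L} → Subsquare (conjugate σ L) → Subsquare L
  conjugate-subsquare⁻ σ {L} sub i j with q , eq ← sub i j = q , (begin
    L (i ↑ˡ k) (j ↑ˡ k)                                  ≡⟨ cong₂ L (⊕-low Perm.id σ i) (⊕-low Perm.id σ j) ⟨
    L (s ⟨$⟩ʳ (i ↑ˡ k)) (s ⟨$⟩ʳ (j ↑ˡ k))                 ≡⟨ inverseʳ s ⟨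
    s ⟨$⟩ʳ conjugate σ L (i ↑ˡ k) (j ↑ˡ k)               ≡⟨ cong (s ⟨$⟩ʳ_) eq ⟩
    s ⟨$⟩ʳ (q ↑ˡ k)                                      ≡⟨ ⊕-low Perm.id σ q ⟩
    q ↑ˡ k                                               ∎)
    where
    open ≡-Reasoning
    s = Perm.id ⊕ σ

  -- If the two copies agree, then the inverse of `s` followed by `t` is an automorphism of `L`
  -- fixing the low points, hence the identity by `rigid`.
  conjugate-free : k ≤ suc m → ∀ {σ ρ L} → ReducedLatin L → ¬ Subsquare L →
    conjugate σ L ≗₂ conjugate ρ L → σ Perm.≈ ρ
  conjugate-free k≤1+m {σ} {ρ} {L} rl ¬sub eq j = ↑ʳ-injective m _ _ (begin
    m ↑ʳ (σ ⟨$⟩ʳ j)                          ≡⟨ ⊕-high Perm.id σ j ⟨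
    s ⟨$⟩ʳ (m ↑ʳ j)                          ≡⟨ rigid k≤1+m rl ¬sub θ auto θ-low (s ⟨$⟩ʳ (m ↑ʳ j)) ⟨
    t ⟨$⟩ʳ (s ⟨$⟩ˡ (s ⟨$⟩ʳ (m ↑ʳ j)))         ≡⟨ cong (t ⟨$⟩ʳ_) (inverseˡ s {m ↑ʳ j}) ⟩
    t ⟨$⟩ʳ (m ↑ʳ j)                          ≡⟨ ⊕-high Perm.id ρ j ⟩
    m ↑ʳ (ρ ⟨$⟩ʳ j)                          ∎)
    where
    open ≡-Reasoning
    s = Perm.id ⊕ σ
    t = Perm.id ⊕ ρ
    θ : Fin (m + k) → Fin (m + k)
    θ x = t ⟨$⟩ʳ (s ⟨$⟩ˡ x)

    auto : ∀ x y → θ (L x y) ≡ L (θ x) (θ y)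
    auto x y = begin
      t ⟨$⟩ʳ (s ⟨$⟩ˡ L x y)
        ≡⟨ cong (λ z → t ⟨$⟩ʳ (s ⟨$⟩ˡ z)) (cong₂ L (inverseʳ s) (inverseʳ s)) ⟨
      t ⟨$⟩ʳ conjugate σ L (s ⟨$⟩ˡ x) (s ⟨$⟩ˡ y)
        ≡⟨ cong (t ⟨$⟩ʳ_) (eq (s ⟨$⟩ˡ x) (s ⟨$⟩ˡ y)) ⟩
      t ⟨$⟩ʳ conjugate ρ L (s ⟨$⟩ˡ x) (s ⟨$⟩ˡ y)                       ≡⟨ inverseʳ t ⟩
      L (θ x) (θ y)                                                    ∎

    θ-low : ∀ i → θ (i ↑ˡ k) ≡ i ↑ˡ k
    -- The inverse map of `s` computes to the forward map of `Perm.id ⊕ flip σ`.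
    θ-low i = trans (cong (t ⟨$⟩ʳ_) (⊕-low Perm.id (flip σ) i)) (⊕-low Perm.id ρ i)

  -- Undoing the renaming by `ρ` on both sides leaves `M` as a copy of `L`, renamed by the inverse
  -- of `ρ` followed by `σ`.
  conjugate-linked : ∀ σ ρ {L M} → conjugate σ L ≗₂ conjugate ρ M → M ≗₂ conjugate (flip ρ ∘ₚ σ) L
  conjugate-linked σ ρ {L} {M} eq i j = begin
    M i j                                                           ≡⟨ cong₂ M (inverseʳ t) (inverseʳ t) ⟨
    M (t ⟨$⟩ʳ i′) (t ⟨$⟩ʳ j′)                                         ≡⟨ inverseʳ t ⟨
    t ⟨$⟩ʳ conjugate ρ M i′ j′                                       ≡⟨ cong (t ⟨$⟩ʳ_) (eq i′ j′) ⟨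
    t ⟨$⟩ʳ (s ⟨$⟩ˡ L (s ⟨$⟩ʳ i′) (s ⟨$⟩ʳ j′))
      ≡⟨ cong (λ z → t ⟨$⟩ʳ (s ⟨$⟩ˡ z)) (cong₂ L (u-comp i) (u-comp j)) ⟩
    t ⟨$⟩ʳ (s ⟨$⟩ˡ L (u ⟨$⟩ʳ i) (u ⟨$⟩ʳ j))
      ≡⟨ ⊕-comp Perm.id Perm.id (flip σ) ρ (L (u ⟨$⟩ʳ i) (u ⟨$⟩ʳ j)) ⟩
    u ⟨$⟩ˡ L (u ⟨$⟩ʳ i) (u ⟨$⟩ʳ j)                                    ∎
    where
    open ≡-Reasoning
    s = Perm.id ⊕ σ
    t = Perm.id ⊕ ρ
    u = Perm.id ⊕ (flip ρ ∘ₚ σ)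
    i′ = t ⟨$⟩ˡ i
    j′ = t ⟨$⟩ˡ j
    u-comp : ∀ x → s ⟨$⟩ʳ (t ⟨$⟩ˡ x) ≡ u ⟨$⟩ʳ x
    u-comp = ⊕-comp Perm.id Perm.id (flip ρ) σ

  withoutSubsquare : List (Array (m + k))
  withoutSubsquare = filter (¬? ∘ Subsquare?) (reducedLatins (m′ + k))

  ∈-withoutSubsquare⁺ : ∀ {L} → ReducedLatin L → ¬ Subsquare L → L ∈ withoutSubsquare
  ∈-withoutSubsquare⁺ rl ¬sub = ∈-filter⁺ S (¬? ∘ Subsquare?) (λ {L} {M} → ¬Subsquare-resp {L} {M})
    (∈-reducedLatins⁺ _ rl) ¬sub

  ∈-withoutSubsquare⁻ : ∀ {L} → L ∈ withoutSubsquare → ReducedLatin L × ¬ Subsquare L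
  ∈-withoutSubsquare⁻ L∈ with L∈′ , ¬sub ← ∈-filter⁻ S (¬? ∘ Subsquare?)
      (λ {L} {M} → ¬Subsquare-resp {L} {M}) {xs = reducedLatins (m′ + k)} L∈ =
    ∈-reducedLatins⁻ _ L∈′ , ¬sub

  k!∣withoutSubsquare : k ≤ suc m → k ! ∣ length withoutSubsquare
  k!∣withoutSubsquare k≤1+m = subst (_∣ length withoutSubsquare) (length-permutations k)
    (indexedClasses⇒∣length (permutationₛ k) (arrayₛ (m + k)) (permutations-unique k) conjugate
      (λ {σ} {ρ} {L} {M} → conjugate-cong {σ} {ρ} {L} {M})
      withoutSubsquare
      (Unique.filter⁺ S (¬? ∘ Subsquare?) (reducedLatins-unique _))
      record
        { closed = λ {σ} {L} _ L∈ → let rl , ¬sub = ∈-withoutSubsquare⁻ {L} L∈ in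
            ∈-withoutSubsquare⁺ (conjugate-reducedLatin σ rl) (¬sub ∘ conjugate-subsquare⁻ σ {L})
        ; free = λ {σ} {ρ} {L} L∈ eq → let rl , ¬sub = ∈-withoutSubsquare⁻ {L} L∈ in
            conjugate-free k≤1+m {σ} {ρ} rl ¬sub eq
        ; covers = λ {L} _ → Perm.id , permutations-complete Perm.id , λ i j →
            sym (trans (⊕-id {m} {k} (L _ _)) (cong₂ L (⊕-id {m} {k} i) (⊕-id {m} {k} j)))
        ; linked = λ {σ} {ρ} {L} {M} _ _ _ _ eq →
            flip ρ ∘ₚ σ , permutations-complete (flip ρ ∘ₚ σ) , conjugate-linked σ ρ {L} {M} eq
        })

  -- Squares with the leading subsquare: replacing blocks.

  block : ∀ {L} → Subsquare L → Array m
  block sub i j = proj₁ (sub i j)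

  block-reducedLatin : ∀ {L} → ReducedLatin L → (sub : Subsquare L) → ReducedLatin (block {L} sub)
  block-reducedLatin rl sub = record
    { row-injective = λ r {c} {d} eq → ↑ˡ-injective k c d (row-injective rl (r ↑ˡ k)
        (trans (proj₂ (sub r c)) (trans (cong (_↑ˡ k) eq) (sym (proj₂ (sub r d))))))
    ; column-injective = λ c {r} {s} eq → ↑ˡ-injective k r s (column-injective rl (c ↑ˡ k)
        (trans (proj₂ (sub r c)) (trans (cong (_↑ˡ k) eq) (sym (proj₂ (sub s c))))))
    ; first-row = λ c → ↑ˡ-injective k _ _ (trans (sym (proj₂ (sub zero c))) (first-row rl (c ↑ˡ k)))
    ; first-column = λ r → ↑ˡ-injective k _ _ (trans (sym (proj₂ (sub r zero))) (first-column rl (r ↑ˡ k)))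
    }

  -- Row `i` of the subsquare already contains every low symbol, so a low entry further right would
  -- repeat one.
  upper-right-high : ∀ {L} → ReducedLatin L → Subsquare L → ∀ i c → ∃[ y ] L (i ↑ˡ k) (m ↑ʳ c) ≡ m ↑ʳ y
  upper-right-high {L} rl sub i c with L (i ↑ˡ k) (m ↑ʳ c) in eq
  ... | x with half m k x
  ...   | high y = y , refl
  ...   | low q with j , refl ← injective⇒surjective (row-injective (block-reducedLatin {L} rl sub) i) q =
    contradiction (row-injective rl (i ↑ˡ k) (trans (proj₂ (sub i j)) (sym eq))) low≢high

  lower-left-high : ∀ {L} → ReducedLatin L → Subsquare L → ∀ r j → ∃[ y ] L (m ↑ʳ r) (j ↑ˡ k) ≡ m ↑ʳ y
  lower-left-high {L} rl sub r j with L (m ↑ʳ r) (j ↑ˡ k) in eq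
  ... | x with half m k x
  ...   | high y = y , refl
  ...   | low q with i , refl ← injective⇒surjective (column-injective (block-reducedLatin {L} rl sub) j) q =
    contradiction (column-injective rl (j ↑ˡ k) (trans (proj₂ (sub i j)) (sym eq))) low≢high

  -- The last permutation has only `m′` points because the first column of a reduced square is
  -- prescribed.
  Replacement : Set
  Replacement = Array m × Permutation′ m × Permutation′ m′

  replacementₛ : Setoid 0ℓ 0ℓ
  replacementₛ = DecSetoid.setoid (arrayₛ m) ×ₛ (permutationₛ m ×ₛ permutationₛ m′)

  -- Q becomes the subsquare, σ renames the low symbols of the lower right block, and τ permutes
  -- the columns of the lower left block other than its first.
  replaceBlocks : Replacement → Array (m + k) → Fin m ⊎ Fin k → Fin m ⊎ Fin k → Fin (m + k)
  replaceBlocks (Q , σ , τ) L (inj₁ i) (inj₁ j) = Q i j ↑ˡ k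
  replaceBlocks (Q , σ , τ) L (inj₁ i) (inj₂ c) = L (i ↑ˡ k) (m ↑ʳ c)
  replaceBlocks (Q , σ , τ) L (inj₂ r) (inj₁ j) = L (m ↑ʳ r) ((lift₀ τ ⟨$⟩ʳ j) ↑ˡ k)
  replaceBlocks (Q , σ , τ) L (inj₂ r) (inj₂ c) = σ ⊕ Perm.id ⟨$⟩ʳ L (m ↑ʳ r) (m ↑ʳ c)

  replace : Replacement → Array (m + k) → Array (m + k)
  replace ρ L x y = replaceBlocks ρ L (splitAt m x) (splitAt m y)

  replace-blocks : ∀ ρ L u v → replace ρ L (join m k u) (join m k v) ≡ replaceBlocks ρ L u v
  replace-blocks ρ L u v = cong₂ (replaceBlocks ρ L) (splitAt-join m k u) (splitAt-join m k v)

  blockwise : ∀ {L M : Array (m + k)} → (∀ u v → L (join m k u) (join m k v) ≡ M (join m k u) (join m k v)) → L ≗₂ M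
  blockwise {L} {M} eq x y = trans (sym (cong₂ L (join-splitAt m k x) (join-splitAt m k y)))
    (trans (eq (splitAt m x) (splitAt m y)) (cong₂ M (join-splitAt m k x) (join-splitAt m k y)))

  replaceBlocks-cong : ∀ {ρ ρ′ L M} → Setoid._≈_ replacementₛ ρ ρ′ → L ≗₂ M →
    ∀ u v → replaceBlocks ρ L u v ≡ replaceBlocks ρ′ M u v
  replaceBlocks-cong (Q≈ , σ≈ , τ≈) L≈M (inj₁ i) (inj₁ j) = cong (_↑ˡ k) (Q≈ i j)
  replaceBlocks-cong (Q≈ , σ≈ , τ≈) L≈M (inj₁ i) (inj₂ c) = L≈M _ _
  replaceBlocks-cong {_ , _ , τ} {_ , _ , τ′} {L} {M} (Q≈ , σ≈ , τ≈) L≈M (inj₂ r) (inj₁ j) =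
    trans (L≈M _ _) (cong (λ l → M (m ↑ʳ r) (l ↑ˡ k)) (lift₀-cong τ τ′ τ≈ j))
  replaceBlocks-cong {_ , σ , _} {_ , σ′ , _} {L} {M} (Q≈ , σ≈ , τ≈) L≈M (inj₂ r) (inj₂ c) =
    trans (cong (σ ⊕ Perm.id ⟨$⟩ʳ_) (L≈M _ _))
      (⊕-cong {π = σ} {π′ = σ′} {ρ = Perm.id} {ρ′ = Perm.id} σ≈ (λ _ → refl) (M (m ↑ʳ r) (m ↑ʳ c)))

  module _ (Q : Array m) (σ : Permutation′ m) (τ : Permutation′ m′) {L : Array (m + k)}
           (Q-rl : ReducedLatin Q) (rl : ReducedLatin L) (sub : Subsquare L) where
    private
      ρ = Q , σ , τ
      s = σ ⊕ Perm.id {k}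
      B = replaceBlocks ρ L

      s-injective : ∀ {x y} → s ⟨$⟩ʳ x ≡ s ⟨$⟩ʳ y → x ≡ y
      s-injective = ⟨$⟩ʳ-injective s

      τ-injective : ∀ {i j} → (lift₀ τ ⟨$⟩ʳ i) ↑ˡ k ≡ (lift₀ τ ⟨$⟩ʳ j) ↑ˡ k → i ≡ j
      τ-injective eq = ⟨$⟩ʳ-injective (lift₀ τ) (↑ˡ-injective k _ _ eq)

      -- `s` fixes high symbols, so an equation between a high entry and a renamed entry already
      -- holds before the renaming.
      s-high : ∀ {x y c} → x ≡ m ↑ʳ c → x ≡ s ⟨$⟩ʳ y → x ≡ y
      s-high {c = c} refl eq = s-injective (trans (⊕-high σ Perm.id c) eq)

      -- In an upper row the left entries are low and the right ones high. In a lower row the left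
      -- entries are high, so `s-high` reduces a clash between the two blocks to one within a row of
      -- `L`.
      rows : ∀ u {v w} → B u v ≡ B u w → v ≡ w
      rows (inj₁ i) {inj₁ j} {inj₁ l} eq = cong inj₁ (row-injective Q-rl i (↑ˡ-injective k _ _ eq))
      rows (inj₁ i) {inj₁ j} {inj₂ c} eq =
        contradiction (trans eq (proj₂ (upper-right-high rl sub i c))) low≢high
      rows (inj₁ i) {inj₂ c} {inj₁ j} eq =
        contradiction (trans (sym eq) (proj₂ (upper-right-high rl sub i c))) low≢high
      rows (inj₁ i) {inj₂ c} {inj₂ d} eq = cong inj₂ (↑ʳ-injective m c d (row-injective rl _ eq))
      rows (inj₂ r) {inj₁ j} {inj₁ l} eq = cong inj₁ (τ-injective (row-injective rl _ eq))
      rows (inj₂ r) {inj₁ j} {inj₂ c} eq =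
        contradiction (row-injective rl _ (s-high (proj₂ (lower-left-high rl sub r _)) eq)) low≢high
      rows (inj₂ r) {inj₂ c} {inj₁ j} eq =
        contradiction (row-injective rl _ (s-high (proj₂ (lower-left-high rl sub r _)) (sym eq))) low≢high
      rows (inj₂ r) {inj₂ c} {inj₂ d} eq = cong inj₂ (↑ʳ-injective m c d (row-injective rl _ (s-injective eq)))

      columns : ∀ v {u w} → B u v ≡ B w v → u ≡ w
      columns (inj₁ j) {inj₁ i} {inj₁ l} eq = cong inj₁ (column-injective Q-rl j (↑ˡ-injective k _ _ eq))
      columns (inj₁ j) {inj₁ i} {inj₂ r} eq =
        contradiction (trans eq (proj₂ (lower-left-high rl sub r _))) low≢high
      columns (inj₁ j) {inj₂ r} {inj₁ i} eq =
        contradiction (trans (sym eq) (proj₂ (lower-left-high rl sub r _))) low≢high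
      columns (inj₁ j) {inj₂ r} {inj₂ q} eq = cong inj₂ (↑ʳ-injective m r q (column-injective rl _ eq))
      columns (inj₂ c) {inj₁ i} {inj₁ l} eq = cong inj₁ (↑ˡ-injective k i l (column-injective rl _ eq))
      columns (inj₂ c) {inj₁ i} {inj₂ r} eq =
        contradiction (column-injective rl _ (s-high (proj₂ (upper-right-high rl sub i c)) eq)) low≢high
      columns (inj₂ c) {inj₂ r} {inj₁ i} eq =
        contradiction (column-injective rl _ (s-high (proj₂ (upper-right-high rl sub i c)) (sym eq))) low≢high
      columns (inj₂ c) {inj₂ r} {inj₂ q} eq =
        cong inj₂ (↑ʳ-injective m r q (column-injective rl _ (s-injective eq)))

      first-row-blocks : ∀ v → B (inj₁ zero) v ≡ join m k v
      first-row-blocks (inj₁ j) = cong (_↑ˡ k) (first-row Q-rl j)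
      first-row-blocks (inj₂ c) = first-row rl _

      first-column-blocks : ∀ u → B u (inj₁ zero) ≡ join m k u
      first-column-blocks (inj₁ i) = cong (_↑ˡ k) (first-column Q-rl i)
      -- `lift₀ τ` keeps `zero`, so the entry is still that of `L`.
      first-column-blocks (inj₂ r) = first-column rl _

    replace-reducedLatin : ReducedLatin (replace ρ L)
    replace-reducedLatin = record
      { row-injective = λ x eq → splitAt-injective m k (rows (splitAt m x) eq)
      ; column-injective = λ y eq → splitAt-injective m k (columns (splitAt m y) eq)
      ; first-row = λ y → trans (first-row-blocks (splitAt m y)) (join-splitAt m k y)
      ; first-column = λ x → trans (first-column-blocks (splitAt m x)) (join-splitAt m k x)
      }

  replace-subsquare : ∀ ρ L → Subsquare (replace ρ L)
  replace-subsquare ρ@(Q , _) L i j = Q i j , replace-blocks ρ L (inj₁ i) (inj₁ j)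

  replace-blocks-≡ : ∀ {ρ ρ′ L M} → replace ρ L ≗₂ replace ρ′ M → ∀ u v → replaceBlocks ρ L u v ≡ replaceBlocks ρ′ M u v
  replace-blocks-≡ {ρ} {ρ′} {L} {M} eq u v = trans (sym (replace-blocks ρ L u v))
    (trans (eq (join m k u) (join m k v)) (replace-blocks ρ′ M u v))

  -- The argument of type `Fin k` picks a lower row, from which `σ` and `τ` can be read off; `Q` is
  -- visible in the leading block.
  replace-free : Fin k → ∀ {ρ ρ′ L} → ReducedLatin L → Subsquare L →
    replace ρ L ≗₂ replace ρ′ L → Setoid._≈_ replacementₛ ρ ρ′
  replace-free r {ρ@(Q , σ , τ)} {ρ′@(Q′ , σ′ , τ′)} {L} rl sub eq = Q≈ , σ≈ , τ≈
    where
    blocks : ∀ u v → replaceBlocks ρ L u v ≡ replaceBlocks ρ′ L u v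
    blocks = replace-blocks-≡ {ρ} {ρ′} {L} {L} eq

    Q≈ : Q ≗₂ Q′
    Q≈ i j = ↑ˡ-injective k _ _ (blocks (inj₁ i) (inj₁ j))

    σ≈ : σ Perm.≈ σ′
    -- Each low symbol occurs in row `r` of `L`. The left part of that row is high, so the symbol
    -- lies in the lower right block, where its image under `σ` shows.
    σ≈ i with y , Lry≡i ← injective⇒surjective (row-injective rl (m ↑ʳ r)) (i ↑ˡ k) with half m k y
    ... | low j = contradiction (trans (sym Lry≡i) (proj₂ (lower-left-high rl sub r j))) low≢high
    ... | high c = ↑ˡ-injective k _ _ (trans (sym (image σ)) (trans (blocks (inj₂ r) (inj₂ c)) (image σ′)))
      where
      image : ∀ π → π ⊕ Perm.id ⟨$⟩ʳ L (m ↑ʳ r) (m ↑ʳ c) ≡ (π ⟨$⟩ʳ i) ↑ˡ k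
      image π = trans (cong (π ⊕ Perm.id ⟨$⟩ʳ_) Lry≡i) (⊕-low π Perm.id i)

    τ≈ : τ Perm.≈ τ′
    τ≈ j = suc-injective (↑ˡ-injective k _ _ (row-injective rl _ (blocks (inj₂ r) (inj₁ (suc j)))))

  -- The index that reproduces `L` carries the subsquare of `L` itself, which is why `covers` lets
  -- the index vary with the element.
  replace-block : ∀ {L} (sub : Subsquare L) → L ≗₂ replace (block {L} sub , Perm.id , Perm.id) L
  replace-block {L} sub = blockwise {L} {replace ρ L} λ u v → trans (go u v) (sym (replace-blocks ρ L u v))
    where
    ρ = block {L} sub , Perm.id , Perm.id
    go : ∀ u v → L (join m k u) (join m k v) ≡ replaceBlocks ρ L u v
    go (inj₁ i) (inj₁ j) = proj₂ (sub i j)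
    go (inj₁ i) (inj₂ c) = refl
    go (inj₂ r) (inj₁ j) = cong (λ l → L (m ↑ʳ r) (l ↑ˡ k)) (sym (lift₀-id j))
    go (inj₂ r) (inj₂ c) = sym (⊕-id {m} {k} (L (m ↑ʳ r) (m ↑ʳ c)))

  -- Cancel `σ′` and `τ′`. The orders of composition differ because `σ` acts on the entries and `τ`
  -- on the column positions; the subsquare is taken from `M`.
  replace-linked : ∀ {Q Q′ σ σ′ τ τ′ L M} (sub : Subsquare M) →
    replace (Q , σ , τ) L ≗₂ replace (Q′ , σ′ , τ′) M →
    M ≗₂ replace (block {M} sub , σ ∘ₚ flip σ′ , flip τ′ ∘ₚ τ) L
  replace-linked {Q} {Q′} {σ} {σ′} {τ} {τ′} {L} {M} sub eq =
    blockwise {M} {replace ρ L} λ u v → trans (go u v) (sym (replace-blocks ρ L u v))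
    where
    open ≡-Reasoning
    ρ = block {M} sub , σ ∘ₚ flip σ′ , flip τ′ ∘ₚ τ
    blocks : ∀ u v → replaceBlocks (Q , σ , τ) L u v ≡ replaceBlocks (Q′ , σ′ , τ′) M u v
    blocks = replace-blocks-≡ {Q , σ , τ} {Q′ , σ′ , τ′} {L} {M} eq
    go : ∀ u v → M (join m k u) (join m k v) ≡ replaceBlocks ρ L u v
    go (inj₁ i) (inj₁ j) = proj₂ (sub i j)
    go (inj₁ i) (inj₂ c) = sym (blocks (inj₁ i) (inj₂ c))
    go (inj₂ r) (inj₁ j) = begin
      M (m ↑ʳ r) (j ↑ˡ k)
        ≡⟨ cong (λ l → M (m ↑ʳ r) (l ↑ˡ k)) (inverseʳ (lift₀ τ′)) ⟨
      M (m ↑ʳ r) ((lift₀ τ′ ⟨$⟩ʳ (lift₀ τ′ ⟨$⟩ˡ j)) ↑ˡ k)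
        ≡⟨ blocks (inj₂ r) (inj₁ (lift₀ τ′ ⟨$⟩ˡ j)) ⟨
      L (m ↑ʳ r) ((lift₀ τ ⟨$⟩ʳ (lift₀ τ′ ⟨$⟩ˡ j)) ↑ˡ k)
        ≡⟨ cong (λ l → L (m ↑ʳ r) (l ↑ˡ k)) (lift-comp j) ⟩
      L (m ↑ʳ r) ((lift₀ (flip τ′ ∘ₚ τ) ⟨$⟩ʳ j) ↑ˡ k)                  ∎
      where
      lift-comp : ∀ j → lift₀ τ ⟨$⟩ʳ (lift₀ τ′ ⟨$⟩ˡ j) ≡ lift₀ (flip τ′ ∘ₚ τ) ⟨$⟩ʳ j
      lift-comp zero    = refl
      lift-comp (suc j) = refl
    go (inj₂ r) (inj₂ c) = begin
      M (m ↑ʳ r) (m ↑ʳ c)                                             ≡⟨ inverseˡ (σ′ ⊕ Perm.id) ⟨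
      σ′ ⊕ Perm.id ⟨$⟩ˡ (σ′ ⊕ Perm.id ⟨$⟩ʳ M (m ↑ʳ r) (m ↑ʳ c))
        ≡⟨ cong (σ′ ⊕ Perm.id ⟨$⟩ˡ_) (blocks (inj₂ r) (inj₂ c)) ⟨
      σ′ ⊕ Perm.id ⟨$⟩ˡ (σ ⊕ Perm.id ⟨$⟩ʳ L (m ↑ʳ r) (m ↑ʳ c))
        ≡⟨ ⊕-comp σ (flip σ′) Perm.id Perm.id (L (m ↑ʳ r) (m ↑ʳ c)) ⟩
      (σ ∘ₚ flip σ′) ⊕ (Perm.id ∘ₚ Perm.id) ⟨$⟩ʳ L (m ↑ʳ r) (m ↑ʳ c)   ≡⟨⟩
      (σ ∘ₚ flip σ′) ⊕ Perm.id ⟨$⟩ʳ L (m ↑ʳ r) (m ↑ʳ c)                ∎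

  replacements : List Replacement
  replacements = cartesianProduct (reducedLatins m′) (cartesianProduct (permutations m) (permutations m′))

  private
    Sₘ = DecSetoid.setoid (arrayₛ m)
    module ρ = Membership replacementₛ

  replacements-unique : Unique replacementₛ replacements
  replacements-unique = Unique.cartesianProduct⁺ Sₘ (permutationₛ m ×ₛ permutationₛ m′) (reducedLatins-unique m′)
    (Unique.cartesianProduct⁺ (permutationₛ m) (permutationₛ m′) (permutations-unique m) (permutations-unique m′))

  ∈-replacements⁺ : ∀ {Q} σ τ → ReducedLatin Q → (Q , σ , τ) ρ.∈ replacements
  ∈-replacements⁺ {Q} σ τ rl = ∈-cartesianProduct⁺ Sₘ (permutationₛ m ×ₛ permutationₛ m′) {x = Q} {y = σ , τ}
    (∈-reducedLatins⁺ m′ {Q} rl)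
    (∈-cartesianProduct⁺ (permutationₛ m) (permutationₛ m′) {x = σ} {y = τ}
      (permutations-complete σ) (permutations-complete τ))

  ∈-replacements⁻ : ∀ {Q σ τ} → (Q , σ , τ) ρ.∈ replacements → ReducedLatin Q
  ∈-replacements⁻ {Q} {σ} {τ} ρ∈ = ∈-reducedLatins⁻ m′ {Q} (proj₁ (∈-cartesianProduct⁻ Sₘ (permutationₛ m ×ₛ permutationₛ m′)
    (reducedLatins m′) (cartesianProduct (permutations m) (permutations m′)) {Q , σ , τ} ρ∈))

  length-replacements : length replacements ≡ m ! * m′ ! * R m
  length-replacements = begin
    length replacements                              ≡⟨ length-cartesianProductWith _,_ (reducedLatins m′) _ ⟩
    R m * length (cartesianProduct (permutations m) (permutations m′))
      ≡⟨ cong (R m *_) (length-cartesianProductWith _,_ (permutations m) (permutations m′)) ⟩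
    R m * (length (permutations m) * length (permutations m′))
      ≡⟨ cong (R m *_) (cong₂ _*_ (length-permutations m) (length-permutations m′)) ⟩
    R m * (m ! * m′ !)                               ≡⟨ *-comm (R m) (m ! * m′ !) ⟩
    m ! * m′ ! * R m                                 ∎
    where open ≡-Reasoning

  withSubsquare : List (Array (m + k))
  withSubsquare = filter Subsquare? (reducedLatins (m′ + k))

  ∈-withSubsquare⁺ : ∀ {L} → ReducedLatin L → Subsquare L → L ∈ withSubsquare
  ∈-withSubsquare⁺ rl sub = ∈-filter⁺ S Subsquare? (λ {L} {M} → Subsquare-resp {L} {M}) (∈-reducedLatins⁺ _ rl) sub

  ∈-withSubsquare⁻ : ∀ {L} → L ∈ withSubsquare → ReducedLatin L × Subsquare L
  ∈-withSubsquare⁻ L∈ with L∈′ , sub ← ∈-filter⁻ S Subsquare?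
      (λ {L} {M} → Subsquare-resp {L} {M}) {xs = reducedLatins (m′ + k)} L∈ =
    ∈-reducedLatins⁻ _ L∈′ , sub

  m!m′!R∣withSubsquare : Fin k → m ! * m′ ! * R m ∣ length withSubsquare
  m!m′!R∣withSubsquare r = subst (_∣ length withSubsquare) length-replacements
    (indexedClasses⇒∣length replacementₛ (arrayₛ (m + k)) replacements-unique replace
      (λ {ρ} {ρ′} {L} {M} ρ≈ L≈M x y → replaceBlocks-cong {ρ} {ρ′} {L} {M} ρ≈ L≈M (splitAt m x) (splitAt m y))
      withSubsquare
      (Unique.filter⁺ S Subsquare? (reducedLatins-unique _))
      record
        { closed = λ {ρ@(Q , σ , τ)} {L} ρ∈ L∈ → let rl , sub = ∈-withSubsquare⁻ {L} L∈ in
            ∈-withSubsquare⁺ {replace ρ L}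
              (replace-reducedLatin Q σ τ {L} (∈-replacements⁻ {Q} {σ} {τ} ρ∈) rl sub)
              (replace-subsquare ρ L)
        ; free = λ {ρ} {ρ′} {L} L∈ eq → let rl , sub = ∈-withSubsquare⁻ {L} L∈ in
            replace-free r {ρ} {ρ′} {L} rl sub eq
        ; covers = λ {L} L∈ → let rl , sub = ∈-withSubsquare⁻ {L} L∈ in
            (block {L} sub , Perm.id , Perm.id)
            , ∈-replacements⁺ Perm.id Perm.id (block-reducedLatin {L} rl sub)
            , replace-block {L} sub
        ; linked = λ {(Q , σ , τ)} {(Q′ , σ′ , τ′)} {L} {M} _ M∈ _ _ eq →
            let rl , sub = ∈-withSubsquare⁻ {M} M∈ in
            (block {M} sub , σ ∘ₚ flip σ′ , flip τ′ ∘ₚ τ)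
            , ∈-replacements⁺ (σ ∘ₚ flip σ′) (flip τ′ ∘ₚ τ) (block-reducedLatin {M} rl sub)
            , replace-linked {Q} {Q′} {σ} {σ′} {τ} {τ′} {L} {M} sub eq
        })

  -- Adding the two counts.

  R-split : R (m + k) ≡ length withSubsquare + length withoutSubsquare
  R-split = length-filter-¬ Subsquare? (reducedLatins (m′ + k))

theorem2 : (n : ℕ) → n ≥ 1 →
    (gcd ((n !) * ((n ∸ 1) !) * R n) ((n + 1) !) ∣ R (2 * n + 1))
    × ((n !) ∣ R (2 * n))
theorem2 n@(suc m′) _ = odd , even
  where
  odd : gcd (n ! * m′ ! * R n) ((n + 1) !) ∣ R (2 * n + 1)
  odd = subst (λ N → gcd (n ! * m′ ! * R n) ((n + 1) !) ∣ R N) n+[n+1]≡2n+1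
    (subst (gcd (n ! * m′ ! * R n) ((n + 1) !) ∣_) (sym (R-split m′ (n + 1)))
      (∣m∣n⇒∣m+n
        -- The first argument of the gcd divides one count and the second divides the other;
        -- `k = n + 1` meets the bound `k ≤ suc m` with equality.
        (∣-trans (gcd[m,n]∣m (n ! * m′ ! * R n) ((n + 1) !)) (m!m′!R∣withSubsquare m′ (n + 1) zero))
        (∣-trans (gcd[m,n]∣n (n ! * m′ ! * R n) ((n + 1) !))
          (k!∣withoutSubsquare m′ (n + 1) (≤-reflexive (+-comm n 1))))))
    where
    n+[n+1]≡2n+1 : n + (n + 1) ≡ 2 * n + 1
    n+[n+1]≡2n+1 = trans (sym (+-assoc n n 1)) (cong (λ l → n + l + 1) (sym (+-identityʳ n)))

  even : n ! ∣ R (2 * n)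
  even = subst (λ N → n ! ∣ R N) (cong (n +_) (sym (+-identityʳ n)))
    (subst (n ! ∣_) (sym (R-split m′ n))
      (∣m∣n⇒∣m+n
        -- With `k = n` both counts are multiples of `n !`, which is a factor of `n ! * m′ ! * R n`.
        (∣-trans (∣m⇒∣m*n (R n) (m∣m*n {n !} (m′ !))) (m!m′!R∣withSubsquare m′ n zero))
        (k!∣withoutSubsquare m′ n (n≤1+n n))))
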